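{- Let $n\geq 9$ and let $Q=\{0,\ldots,n-1\}^2$. Let $A_n\subset Q$ be a configuration consisting of the $n\times n$ 'L' oriented like the letter L with span $Q$, together with $\left\lfloor\frac{n-2}{2}\right\rfloor$ additional coins placed at free positions of the bottom row of $Q$. Let $B_n\subset Q$ be a configuration consisting of an $n\times 1$ 'L' in the top row of $Q$, an $n\times 1$ 'L' in the bottom row of $Q$, and $\left\lfloor\frac{n-5}{2}\right\rfloor$ additional coins placed at free positions of the bottom row of $Q$. Then $A_n\not\to B_n$ (i.e. $B_n$ cannot be reached from $A_n$), even though $A_n$ has $\left\lfloor\frac{n-2}{2}\right\rfloor$ extra coins, $B_n$ has $\left\lfloor\frac{n-5}{2}\right\rfloor$ redundant coins, and $\mathrm{span}(A_n)\supset\mathrm{span}(B_n)$.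
   Context: The board is the square grid: positions are the elements $(x,y)$ of $\mathbb{Z}^2$, each position having four neighbors (left, right, top, bottom). A configuration is a finite subset $C\subset\mathbb{Z}^2$; its elements are called coins. A (legal) move $c\mapsto p$ from a configuration $A$ takes $c\in A$ and $p\notin A$ such that $p$ has at least two neighbors in $A\setminus\{c\}$, and produces $(A\setminus\{c\})\cup\{p\}$. We write $A\to B$ if $B$ can be obtained from $A$ by a finite (possibly empty) sequence of moves. The span of a configuration $C$, $\mathrm{span}(C)$, is the limit of the (eventually constant) sequence $C_0=C$, $C_{i+1}=C_i\cup\{p\notin C_i : p \text{ has at least two neighbors in } C_i\}$. The $n\times n$ 'L' oriented like the letter L with span $Q=\{0,\ldots,n-1\}^2$ is the set of $n$ positions obtained as follows: follow the path of positions from the top-left corner $(0,n-1)$ straight down to $(0,0)$ and then straight right to the bottom-right corner $(n-1,0)$, number its positions $0,1,\ldots,2n-2$ in order, and take those with even number. An $n\times 1$ 'L' in a row of $Q$ is a set of exactly $\left\lceil\frac{n+1}{2}\right\rceil$ positions of that row, containing both end positions of the row, such that consecutive ones are at distance 1 or 2 (so all consecutive distances are 2 if $n$ is odd, and all but exactly one are 2 if $n$ is even). A configuration $A$ has $k$ extra coins if there is $A'\subset A$ with $|A'|=k$ and $\mathrm{span}(A\setminus A')=\mathrm{span}(A)$. A configuration $B$ has $k$ redundant coins if there are $k$ distinct coins $b_1,\ldots,b_k\in B$ such that for all $i$, $b_i$ has at least two neighbors in $B\setminus\{b_1,\ldots,b_{i-1}\}$. -}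

module Defs where

open import Data.Fin as Fin using (Fin)
open import Data.Integer as ℤ using (ℤ; +_; _+_; _-_)
open import Data.List using (List; []; _∷_; length)
open import Data.List.Membership.Propositional using () renaming (_∈_ to _∈ₗ_)
open import Data.List.Relation.Unary.Unique.Propositional using (Unique)
open import Data.Nat as ℕ using (ℕ; zero; suc; _∸_; _≥_; ⌈_/2⌉; ⌊_/2⌋)
open import Data.Nat.Divisibility using (_∣_)
open import Data.Product using (_×_; _,_; proj₂; Σ-syntax; ∃-syntax)
open import Data.Sum using (_⊎_)
open import Function.Definitions using (Injective)
open import Level using (0ℓ)
open import Relation.Binary.Construct.Closure.ReflexiveTransitive using (Star)
open import Relation.Binary.PropositionalEquality using (_≡_; _≢_)
open import Relation.Unary using (Pred; _∈_; _∉_; _⊆_; _≐_; _∪_; _∩_; _∖_; ∁; ｛_｝)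

Position : Set
Position = ℤ × ℤ

neighbours : Position → List Position
neighbours (x , y) =
  (x - + 1 , y) ∷ (x + + 1 , y) ∷ (x , y + + 1) ∷ (x , y - + 1) ∷ []

PosSet : Set₁
PosSet = Pred Position 0ℓ

TwoNeighboursIn : PosSet → PosSet
TwoNeighboursIn S p =
  ∃[ q ] ∃[ r ] (q ≢ r × q ∈ₗ neighbours p × r ∈ₗ neighbours p × q ∈ S × r ∈ S)

-- A finite subset of ℤ², represented by a duplicate-free list.  The order of
-- the list is irrelevant: configurations are only ever compared through the
-- sets ⟦_⟧ they represent.
record Configuration : Set where
  constructor config
  field
    coins    : List Position
    distinct : Unique coins

open Configuration public

⟦_⟧ : Configuration → PosSet
⟦ C ⟧ p = p ∈ₗ coins C

size : Configuration → ℕ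
size C = length (coins C)

record Move (A B : Configuration) : Set where
  field
    c p     : Position
    c∈A     : c ∈ ⟦ A ⟧
    p∉A     : p ∉ ⟦ A ⟧
    support : p ∈ TwoNeighboursIn (⟦ A ⟧ ∖ ｛ c ｝)
    result  : ⟦ B ⟧ ≐ (⟦ A ⟧ ∖ ｛ c ｝) ∪ ｛ p ｝

-- The last component makes the empty sequence of moves relate any two lists
-- that represent the same set.
infix 4 _⇝_
_⇝_ : Configuration → Configuration → Set
A ⇝ B = ∃[ C ] (Star Move A C × ⟦ C ⟧ ≐ ⟦ B ⟧)

stage : PosSet → ℕ → PosSet
stage S zero    = S
stage S (suc i) = stage S i ∪ (∁ (stage S i) ∩ TwoNeighboursIn (stage S i))

-- The limit of the sequence of stages: the positions that belong to all
-- sufficiently late stages.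
span : PosSet → PosSet
span S p = ∃[ N ] (∀ i → i ≥ N → p ∈ stage S i)

HasExtraCoins : ℕ → Configuration → Set
HasExtraCoins k A =
  ∃[ A′ ] (⟦ A′ ⟧ ⊆ ⟦ A ⟧ × size A′ ≡ k × span (⟦ A ⟧ ∖ ⟦ A′ ⟧) ≐ span ⟦ A ⟧)

HasRedundantCoins : ℕ → Configuration → Set
HasRedundantCoins k B =
  Σ[ b ∈ (Fin k → Position) ]
    ( Injective _≡_ _≡_ b
    × (∀ i → b i ∈ ⟦ B ⟧)
    × (∀ i → b i ∈ TwoNeighboursIn (⟦ B ⟧ ∖ λ q → ∃[ j ] (j Fin.< i × q ≡ b j))))

Q : ℕ → PosSet
Q n (x , y) = (+ 0 ℤ.≤ x × x ℤ.< + n) × (+ 0 ℤ.≤ y × y ℤ.< + n)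

row : ℕ → ℤ → PosSet
row n y = Q n ∩ λ p → proj₂ p ≡ y

bottom : ℤ
bottom = + 0

top : ℕ → ℤ
top n = + (n ∸ 1)

-- Position number k (0 ≤ k ≤ 2n - 2) on the path from (0 , n - 1) down to
-- (0 , 0) and then right to (n - 1 , 0).  Truncated subtraction keeps the
-- first coordinate at 0 on the way down and the second at 0 on the way right.
path : ℕ → ℕ → Position
path n k = + (k ∸ (n ∸ 1)) , + ((n ∸ 1) ∸ k)

L : ℕ → PosSet
L n p = ∃[ k ] (k ℕ.≤ 2 ℕ.* n ∸ 2 × 2 ∣ k × p ≡ path n k)

record IsRowL (n : ℕ) (y : ℤ) (S : Configuration) : Set where
  field
    inRow    : ⟦ S ⟧ ⊆ row n y
    count    : size S ≡ ⌈ n ℕ.+ 1 /2⌉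
    leftEnd  : (+ 0 , y) ∈ ⟦ S ⟧
    rightEnd : (+ (n ∸ 1) , y) ∈ ⟦ S ⟧
    gaps     : ∀ x x′ → (x , y) ∈ ⟦ S ⟧ → (x′ , y) ∈ ⟦ S ⟧ → x ℤ.< x′ →
               (∀ z → x ℤ.< z → z ℤ.< x′ → (z , y) ∉ ⟦ S ⟧) →
               x′ - x ≡ + 1 ⊎ x′ - x ≡ + 2

-- C consists of S together with k coins at positions of the bottom row of Q
-- that are not in S.
WithBottomCoins : ℕ → PosSet → ℕ → Configuration → Set
WithBottomCoins n S k C =
  ∃[ E ] (size E ≡ k × ⟦ E ⟧ ⊆ row n bottom × ⟦ E ⟧ ⊆ ∁ S × ⟦ C ⟧ ≐ S ∪ ⟦ E ⟧)

IsA : ℕ → Configuration → Set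
IsA n A = ⟦ A ⟧ ⊆ Q n × WithBottomCoins n (L n) ⌊ n ∸ 2 /2⌋ A

IsB : ℕ → Configuration → Set
IsB n B =
  ⟦ B ⟧ ⊆ Q n ×
  ∃[ T ] ∃[ U ] (IsRowL n (top n) T × IsRowL n bottom U ×
                 WithBottomCoins n (⟦ T ⟧ ∪ ⟦ U ⟧) ⌊ n ∸ 5 /2⌋ B)

{-# OPTIONS --safe #-}
module Submission where

-- Call a set closed if it contains every position with two neighbours in it;
-- then span S is the least closed set containing S.  Every configuration on a
-- route from A to B has a span containing the top and the bottom row of Q, and
-- we show that it is even all of Q, which fails for B.  The only way to lose
-- this is to remove a coin c such that the span X of the remaining coins M
-- misses part of Q.  Next to a full row, every row of X is either full or
-- empty, and two consecutive empty rows of X can only be bridged by c lying in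
-- one of them; so all rows but at most three consecutive ones are full.  The
-- perimeter does not increase when a span is filled, and 2 |M| bounds the half
-- of the perimeter that consists of right and upper sides.  Each column of X
-- has at least two upper boundary sides and each of at least n - 3 rows a
-- right one, so 2 |M| ≥ 3 n - 3, which is more coins than A has without c.

open import Defs
open import Data.Empty using (⊥; ⊥-elim)
open import Data.Fin using (zero; suc)
open import Data.Integer as ℤ using (ℤ; +_; +≤+; +<+)
import Data.Integer.Properties as ℤ
open import Data.List using (List; []; _∷_; _++_; length; filter; map; applyUpTo;
  cartesianProduct; lookup)
open import Data.List.Properties using (filter-notAll; length-++; length-map; length-applyUpTo)
open import Data.List.Membership.Propositional using (find; lose)
  renaming (_∈_ to _∈ₗ_; _∉_ to _∉ₗ_)
open import Data.List.Membership.Propositional.Properties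
open import Data.List.Relation.Binary.Disjoint.Propositional using (Disjoint)
open import Data.List.Relation.Unary.All as All using (All; []; _∷_)
import Data.List.Relation.Unary.All.Properties as All
open import Data.List.Relation.Unary.AllPairs using ([]; _∷_)
open import Data.List.Relation.Unary.Any as Any using (Any; here; there; any?)
open import Data.List.Relation.Unary.Unique.Propositional using (Unique)
import Data.List.Relation.Unary.Unique.Propositional.Properties as Unique
open import Data.Nat using (ℕ; zero; suc; _+_; _*_; _≤_; _<_; z≤n; s≤s; s≤s⁻¹; _≥_; _∸_; ⌊_/2⌋)
open import Data.Nat.Divisibility using (divides)
open import Data.Nat.Properties
open import Data.Nat.Tactic.RingSolver using (solve-∀)
open import Data.Product using (_×_; _,_; proj₁; proj₂; ∃-syntax)
open import Data.Product.Properties using (≡-dec)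
open import Data.Sum using (_⊎_; inj₁; inj₂; [_,_]′)
open import Data.Unit using (⊤; tt)
open import Function using (_∘_; id)
open import Function.Definitions using (Injective)
open import Level using (0ℓ)
open import Relation.Binary using (DecidableEquality)
open import Relation.Binary.Construct.Closure.ReflexiveTransitive using (Star; ε; _◅_)
open import Relation.Binary.PropositionalEquality
open import Relation.Nullary using (¬_; yes; no; ¬?; contradiction)
open import Relation.Nullary.Decidable using (map′; _×-dec_; _⊎-dec_)
open import Relation.Unary using (Pred; Decidable; _∈_; _∉_; _⊆_; _⊇_; _∪_; _∖_; ｛_｝)

_≟ᵖ_ : DecidableEquality Position
_≟ᵖ_ = ≡-dec ℤ._≟_ ℤ._≟_

open import Data.List.Membership.DecPropositional _≟ᵖ_ using (_∈?_)

-- Duplicate-free lists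

lookup-injective : ∀ {A : Set} {xs : List A} → Unique xs → Injective _≡_ _≡_ (lookup xs)
lookup-injective (x∉xs ∷ uniq) {zero}  {zero}  eq = refl
lookup-injective (x∉xs ∷ uniq) {zero}  {suc j} eq = contradiction eq (All.lookup x∉xs (∈-lookup j))
lookup-injective (x∉xs ∷ uniq) {suc i} {zero}  eq = contradiction (sym eq) (All.lookup x∉xs (∈-lookup i))
lookup-injective (x∉xs ∷ uniq) {suc i} {suc j} eq = cong suc (lookup-injective uniq eq)

module _ {A : Set} (_≟ᴬ_ : DecidableEquality A) where

  Unique-⊆⇒length-≤ : ∀ {xs ys : List A} → Unique xs → (_∈ₗ xs) ⊆ (_∈ₗ ys) →
                      length xs ≤ length ys
  Unique-⊆⇒length-≤ {[]} _ _ = z≤n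
  Unique-⊆⇒length-≤ {x ∷ xs} {ys} (x∉xs ∷ uniq) xs⊆ys = ≤-<-trans
    (Unique-⊆⇒length-≤ uniq λ z∈xs →
      ∈-filter⁺ ≢x? (xs⊆ys (there z∈xs)) λ z≡x → All.lookup x∉xs z∈xs (sym z≡x))
    (filter-notAll ≢x? ys (Any.map (λ x≡z z≢x → z≢x (sym x≡z)) (xs⊆ys (here refl))))
    where ≢x? = λ z → ¬? (z ≟ᴬ x)

-- Closed sets of positions

Closed : PosSet → Set
Closed X = TwoNeighboursIn X ⊆ X

infix 4 _Spans_
-- Quantifying over closed supersets expresses that `R` lies in the span of `S` without constructing
-- that span, so that arguments about moves become compositions of inclusions.
_Spans_ : PosSet → PosSet → Set₁
S Spans R = ∀ X → Closed X → S ⊆ X → R ⊆ X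

TwoNeighboursIn-mono : ∀ {S T} → S ⊆ T → TwoNeighboursIn S ⊆ TwoNeighboursIn T
TwoNeighboursIn-mono S⊆T (q , r , q≢r , q∈ , r∈ , qS , rS) =
  q , r , q≢r , q∈ , r∈ , S⊆T qS , S⊆T rS

twoNeighbours? : ∀ {S} → Decidable S → Decidable (TwoNeighboursIn S)
twoNeighbours? {S} S? p = map′ to from
  (any? (λ q → any? (λ r → ¬? (q ≟ᵖ r) ×-dec (S? q ×-dec S? r)) (neighbours p)) (neighbours p))
  where
  to : Any (λ q → Any (λ r → q ≢ r × S q × S r) (neighbours p)) (neighbours p) →
       TwoNeighboursIn S p
  to any =
    let q , q∈ , any′ = find any
        r , r∈ , q≢r , qS , rS = find any′
    in q , r , q≢r , q∈ , r∈ , qS , rS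
  from : TwoNeighboursIn S p →
         Any (λ q → Any (λ r → q ≢ r × S q × S r) (neighbours p)) (neighbours p)
  from (q , r , q≢r , q∈ , r∈ , qS , rS) = lose q∈ (lose r∈ (q≢r , qS , rS))

pattern west  = here refl
pattern east  = there (here refl)
pattern north = there (there (here refl))
pattern south = there (there (there (here refl)))

MidClosed : Pred ℤ 0ℓ → Set
MidClosed P = ∀ z → P (z ℤ.- + 1) → P (z ℤ.+ + 1) → P z

-- Two distinct neighbours are either opposite, and then `MidClosed` in their direction applies, or
-- one is vertical and one horizontal. In the latter case the vertical one shares the first
-- coordinate with the centre and the horizontal one the second.
×-closed : ∀ {P R} → MidClosed P → MidClosed R → Closed (λ p → P (proj₁ p) × R (proj₂ p))
×-closed midP midR (_ , _ , q≢r , west  , west  , _) = contradiction refl q≢r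
×-closed midP midR (_ , _ , _ , west  , east  , (a , b) , (c , d)) = midP _ a c , b
×-closed midP midR (_ , _ , _ , west  , north , (a , b) , (c , d)) = c , b
×-closed midP midR (_ , _ , _ , west  , south , (a , b) , (c , d)) = c , b
×-closed midP midR (_ , _ , _ , east  , west  , (a , b) , (c , d)) = midP _ c a , b
×-closed midP midR (_ , _ , q≢r , east  , east  , _) = contradiction refl q≢r
×-closed midP midR (_ , _ , _ , east  , north , (a , b) , (c , d)) = c , b
×-closed midP midR (_ , _ , _ , east  , south , (a , b) , (c , d)) = c , b
×-closed midP midR (_ , _ , _ , north , west  , (a , b) , (c , d)) = a , d
×-closed midP midR (_ , _ , _ , north , east  , (a , b) , (c , d)) = a , d
×-closed midP midR (_ , _ , q≢r , north , north , _) = contradiction refl q≢r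
×-closed midP midR (_ , _ , _ , north , south , (a , b) , (c , d)) = a , midR _ d b
×-closed midP midR (_ , _ , _ , south , west  , (a , b) , (c , d)) = a , d
×-closed midP midR (_ , _ , _ , south , east  , (a , b) , (c , d)) = a , d
×-closed midP midR (_ , _ , _ , south , north , (a , b) , (c , d)) = a , midR _ b d
×-closed midP midR (_ , _ , q≢r , south , south , _) = contradiction refl q≢r

rows-closed : ∀ {R} → MidClosed R → Closed (λ p → R (proj₂ p))
rows-closed {R} midR =
  proj₂ ∘ ×-closed {P = λ _ → ⊤} _ midR ∘ TwoNeighboursIn-mono {T = λ p → ⊤ × R (proj₂ p)} (tt ,_)

Q-closed : ∀ n → Closed (Q n)
Q-closed n = ×-closed mid mid
  where
  mid : MidClosed (λ z → + 0 ℤ.≤ z × z ℤ.< + n)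
  mid z (0≤z-1 , _) (_ , z+1<n) =
    ℤ.≤-trans 0≤z-1 (ℤ.i-j≤i z (+ 1)) , ℤ.≤-<-trans (ℤ.i≤i+j z (+ 1)) z+1<n

-1+1 : ∀ z → (z ℤ.- + 1) ℤ.+ + 1 ≡ z
-1+1 z = trans (ℤ.+-assoc z (ℤ.- + 1) (+ 1)) (ℤ.+-identityʳ z)

+m+1 : ∀ m → + m ℤ.+ + 1 ≡ + suc m
+m+1 m = cong +_ (+-comm m 1)

z-1≡⇒ : ∀ z {m} → z ℤ.- + 1 ≡ + m → z ℤ.+ + 1 ≡ + suc (suc m)
z-1≡⇒ z {m} eq = begin
  z ℤ.+ + 1                       ≡⟨ cong (ℤ._+ + 1) (-1+1 z) ⟨
  ((z ℤ.- + 1) ℤ.+ + 1) ℤ.+ + 1   ≡⟨ cong (λ w → (w ℤ.+ + 1) ℤ.+ + 1) eq ⟩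
  (+ m ℤ.+ + 1) ℤ.+ + 1           ≡⟨ cong (ℤ._+ + 1) (+m+1 m) ⟩
  + suc m ℤ.+ + 1                 ≡⟨ +m+1 (suc m) ⟩
  + suc (suc m)                   ∎
  where open ≡-Reasoning

-- A position between the lines could have a neighbour on each only if they were at distance 2; this
-- is where `3 ≤ m` enters.
twoLines-closed : ∀ {m} → 3 ≤ m → Closed (λ p → proj₂ p ≡ + 0 ⊎ proj₂ p ≡ + m)
twoLines-closed {m} 3≤m = rows-closed mid
  where
  mid : MidClosed (λ z → z ≡ + 0 ⊎ z ≡ + m)
  mid z (inj₁ a) (inj₁ b) with () ← trans (sym (z-1≡⇒ z a)) b
  mid z (inj₁ a) (inj₂ b) =
    contradiction 3≤m (<⇒≱ (≤-reflexive (cong suc (sym (ℤ.+-injective (trans (sym (z-1≡⇒ z a)) b))))))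
  mid z (inj₂ a) (inj₁ b) with () ← trans (sym (z-1≡⇒ z a)) b
  mid z (inj₂ a) (inj₂ b) =
    contradiction (ℤ.+-injective (trans (sym (z-1≡⇒ z a)) b)) (m≢1+n+m m ∘ sym)

-- A position in one of the two rows has three of its neighbours inside these rows, hence at most
-- one in the set. A single omitted row could be filled from both sides at once.
twoRowsOmitted-closed : ∀ b → Closed (λ p → proj₂ p ≢ + b × proj₂ p ≢ + suc b)
twoRowsOmitted-closed b = rows-closed mid
  where
  mid : MidClosed (λ z → z ≢ + b × z ≢ + suc b)
  mid z (z-1≢b , _) (_ , z+1≢1+b) =
    (λ { refl → z+1≢1+b (+m+1 b) }) , (λ { refl → z-1≢b refl })

-- Filling rows

pt : ℕ → ℕ → Position
pt x y = + x , + y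

pt-x : ∀ {x y x′ y′} → pt x y ≡ pt x′ y′ → x ≡ x′
pt-x refl = refl

pt-y : ∀ {x y x′ y′} → pt x y ≡ pt x′ y′ → y ≡ y′
pt-y refl = refl

module _ {x y : ℕ} where
  west-of : pt x y ∈ₗ neighbours (pt (suc x) y)
  west-of = here refl

  east-of : pt (suc x) y ∈ₗ neighbours (pt x y)
  east-of = there (here (cong (_, + y) (sym (+m+1 x))))

  north-of : pt x (suc y) ∈ₗ neighbours (pt x y)
  north-of = there (there (here (cong (+ x ,_) (sym (+m+1 y)))))

  south-of : pt x y ∈ₗ neighbours (pt x (suc y))
  south-of = there (there (there (here refl)))

Q⇒pt : ∀ {n p} → Q n p → ∃[ x ] ∃[ y ] (x < n × y < n × p ≡ pt x y)
Q⇒pt {p = + x , + y} ((_ , +<+ x<n) , (_ , +<+ y<n)) = x , y , x<n , y<n , refl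

pt∈Q : ∀ {n x y} → x < n → y < n → Q n (pt x y)
pt∈Q x<n y<n = (+≤+ z≤n , +<+ x<n) , (+≤+ z≤n , +<+ y<n)

-- Going down to index 0 and up again makes it unnecessary to compare `x` with `x′`.
spread : ∀ {n} {R : ℕ → Set} →
         (∀ {i} → suc i < n → R i → R (suc i)) → (∀ {i} → suc i < n → R (suc i) → R i) →
         ∀ {x x′} → x < n → x′ < n → R x → R x′
spread {n} {R} inc dec {x} {x′} x<n x′<n = up x′ x′<n ∘ down x x<n
  where
  down : ∀ x → x < n → R x → R 0
  down zero    _   r = r
  down (suc x) x<n r = down x (<-trans (n<1+n x) x<n) (dec x<n r)
  up : ∀ x → x < n → R 0 → R x
  up zero    _   r = r
  up (suc x) x<n r = inc x<n (up x (<-trans (n<1+n x) x<n) r)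

module Rows (n : ℕ) {X : PosSet} (closed : Closed X) where

  Full : ℕ → Set
  Full y = ∀ {x} → x < n → pt x y ∈ X

  -- One position of row `y′` suffices: the next one along the row has it as one neighbour and a
  -- position of the full row `y` as the other. Leaving `adj` open covers the rows above and below
  -- alike.
  fill-adjacent : ∀ {y y′} → (∀ i → pt i y ∈ₗ neighbours (pt i y′)) →
                  Full y → ∀ {x} → x < n → pt x y′ ∈ X → Full y′
  fill-adjacent {y} {y′} adj full x<n x∈X x′<n = spread {R = λ i → pt i y′ ∈ X}
    (λ {i} i<n i∈X → closed (_ , _ , i≢1+i ∘ pt-x , west-of , adj (suc i) , i∈X , full i<n))
    (λ {i} i<n i∈X →
      closed (_ , _ , i≢1+i ∘ sym ∘ pt-x , east-of , adj i , i∈X , full (<-trans (n<1+n i) i<n)))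
    x<n x′<n x∈X
    where
    i≢1+i : ∀ {i} → i ≢ suc i
    i≢1+i = m≢1+n+m _

  fill-between : ∀ {x y} → pt x y ∈ X → pt x (suc (suc y)) ∈ X → pt x (suc y) ∈ X
  fill-between {y = y} a b =
    closed (_ , _ , m≢1+n+m y ∘ pt-y , south-of , north-of , a , b)

  fill-above : ∀ {y} → Full y → ∀ {x} → x < n → pt x (suc y) ∈ X → Full (suc y)
  fill-above = fill-adjacent (λ _ → south-of)

  fill-below : ∀ {y} → Full (suc y) → ∀ {x} → x < n → pt x y ∈ X → Full y
  fill-below = fill-adjacent (λ _ → north-of)

-- Spans

stage-⊆ : ∀ {S X} → Closed X → S ⊆ X → ∀ i → stage S i ⊆ X
stage-⊆ closed S⊆X zero    s = S⊆X s
stage-⊆ closed S⊆X (suc i) (inj₁ s) = stage-⊆ closed S⊆X i s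
stage-⊆ closed S⊆X (suc i) (inj₂ (_ , two)) =
  closed (TwoNeighboursIn-mono (stage-⊆ closed S⊆X i) two)

span-⊆ : ∀ {S X} → Closed X → S ⊆ X → span S ⊆ X
span-⊆ closed S⊆X (N , late) = stage-⊆ closed S⊆X N (late N ≤-refl)

stage-mono : ∀ S {i j} → i ≤ j → stage S i ⊆ stage S j
stage-mono S {zero}  {zero}  _   s = s
stage-mono S {i}     {suc j} i≤j s with m≤n⇒m<n∨m≡n i≤j
... | inj₁ (s≤s i≤j) = inj₁ (stage-mono S i≤j s)
... | inj₂ refl      = s

stage⊆span : ∀ S i → stage S i ⊆ span S
stage⊆span S i s = i , λ j j≥i → stage-mono S j≥i s

stage? : ∀ {S} → Decidable S → ∀ i → Decidable (stage S i)
stage? S? zero    p = S? p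
stage? S? (suc i) p =
  stage? S? i p ⊎-dec (¬? (stage? S? i p) ×-dec twoNeighbours? (stage? S? i) p)

-- Both neighbours are present at stage `N + N′`, so `p` enters one stage later unless it is already
-- there. Stages add only absent positions, hence the case distinction by `stage?`.
span-closed : ∀ {S} → Decidable S → Closed (span S)
span-closed {S} S? {p} (q , r , q≢r , q∈ , r∈ , (N , qs) , (N′ , rs))
  with stage? S? (N + N′) p
... | yes s = stage⊆span S (N + N′) s
... | no ¬s = stage⊆span S (suc (N + N′)) (inj₂ (¬s ,
  q , r , q≢r , q∈ , r∈ , qs _ (m≤m+n N N′) , rs _ (m≤n+m N′ N)))

-- Growing a configuration to a closed set

right up : Position → Position
right (x , y) = x ℤ.+ + 1 , y
up    (x , y) = x , y ℤ.+ + 1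

Edge : Set
Edge = Position × Position

_≟ᵉ_ : DecidableEquality Edge
_≟ᵉ_ = ≡-dec _≟ᵖ_ _≟ᵖ_

-- Orienting every adjacency to the right or upwards gives it exactly one representative, so that
-- edges can be counted by the length of a list.
IsEdge : Edge → Set
IsEdge (p , q) = q ≡ right p ⊎ q ≡ up p

edge : ∀ {p q} → q ∈ₗ neighbours p → ∃[ e ] (IsEdge e × (e ≡ (p , q) ⊎ e ≡ (q , p)))
edge {x , y} west  = _ , inj₁ (cong (_, y) (sym (-1+1 x))) , inj₂ refl
edge         east  = _ , inj₁ refl , inj₁ refl
edge         north = _ , inj₂ refl , inj₁ refl
edge {x , y} south = _ , inj₂ (cong (x ,_) (sym (-1+1 y))) , inj₂ refl

-- Every added position brings two new edges between positions of X; `count`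
-- says that 2 |X| minus the number of edges, half the perimeter, never
-- increases.
record Growth (M X : List Position) : Set₁ where
  field
    distinct  : Unique X
    extensive : (_∈ₗ M) ⊆ (_∈ₗ X)
    spanned   : (_∈ₗ M) Spans (_∈ₗ X)
    edges     : List Edge
    distinctᵉ : Unique edges
    internal  : All (λ e → IsEdge e × proj₁ e ∈ₗ X × proj₂ e ∈ₗ X) edges
    count     : 2 * length X ≤ 2 * length M + length edges

open Growth

start : ∀ {M} → Unique M → Growth M M
start uniq = record
  { distinct  = uniq
  ; extensive = id
  ; spanned   = λ _ _ M⊆Y → M⊆Y
  ; edges     = []
  ; distinctᵉ = []
  ; internal  = []
  ; count     = m≤m+n _ 0
  }

-- The edges from `p` to its two supporting neighbours are new because all earlier edges have both
-- ends in `X`, while `p` is not in `X`. Both sides of `count` thus grow by 2.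
extend : ∀ {M X p} → Growth M X → p ∉ₗ X → p ∈ TwoNeighboursIn (_∈ₗ X) → Growth M (p ∷ X)
extend {M} {X} {p} g p∉X two@(q , r , q≢r , q∈ , r∈ , q∈X , r∈X) with edge q∈ | edge r∈
... | e , isE , e≡ | f , isF , f≡ = record
  { distinct  = All.tabulate (λ z∈X p≡z → p∉X (subst (_∈ₗ X) (sym p≡z) z∈X)) ∷ distinct g
  ; extensive = there ∘ extensive g
  ; spanned   = λ Y closed M⊆Y → λ
      { (here refl) → closed (TwoNeighboursIn-mono (spanned g Y closed M⊆Y) two)
      ; (there z∈X) → spanned g Y closed M⊆Y z∈X }
  ; edges     = e ∷ f ∷ edges g
  ; distinctᵉ = (e≢f e≡ f≡ ∷ new e≡) ∷ new f≡ ∷ distinctᵉ g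
  ; internal  = (isE , endpoints e≡ q∈X) ∷ (isF , endpoints f≡ r∈X) ∷
                All.map (λ (isG , a , b) → isG , there a , there b) (internal g)
  ; count     = begin
      2 * suc (length X)                             ≡⟨ *-suc 2 (length X) ⟩
      2 + 2 * length X                               ≤⟨ +-monoʳ-≤ 2 (count g) ⟩
      2 + (2 * length M + length (edges g))          ≡⟨ +-comm 2 (2 * length M + length (edges g)) ⟩
      2 * length M + length (edges g) + 2            ≡⟨ +-assoc (2 * length M) _ 2 ⟩
      2 * length M + (length (edges g) + 2)          ≡⟨ cong (λ k → 2 * length M + k) (+-comm _ 2) ⟩
      2 * length M + suc (suc (length (edges g)))    ∎
  }
  where
  open ≤-Reasoning
  endpoints : ∀ {q e} → e ≡ (p , q) ⊎ e ≡ (q , p) → q ∈ₗ X → proj₁ e ∈ₗ p ∷ X × proj₂ e ∈ₗ p ∷ X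
  endpoints (inj₁ refl) q∈X = here refl , there q∈X
  endpoints (inj₂ refl) q∈X = there q∈X , here refl
  new : ∀ {q e} → e ≡ (p , q) ⊎ e ≡ (q , p) → All (e ≢_) (edges g)
  new (inj₁ refl) = All.map (λ (_ , a , _) → λ { refl → p∉X a }) (internal g)
  new (inj₂ refl) = All.map (λ (_ , _ , b) → λ { refl → p∉X b }) (internal g)
  e≢f : ∀ {e f} → e ≡ (p , q) ⊎ e ≡ (q , p) → f ≡ (p , r) ⊎ f ≡ (r , p) → e ≢ f
  e≢f (inj₁ refl) (inj₁ refl) refl = q≢r refl
  e≢f (inj₁ refl) (inj₂ refl) refl = p∉X q∈X
  e≢f (inj₂ refl) (inj₁ refl) refl = p∉X q∈X
  e≢f (inj₂ refl) (inj₂ refl) refl = q≢r refl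

-- Each position of `X` is the start of one right and one upper edge, `2 |X|` in all. These include
-- the internal edges and those of `W`, which differ in whether the second end lies in `X`;
-- subtracting the internal ones by `count` leaves `2 |M|`.
boundary-≤ : ∀ {M X W} → Growth M X → Unique W →
             All (λ e → IsEdge e × proj₁ e ∈ₗ X × proj₂ e ∉ₗ X) W →
             length W ≤ 2 * length M
boundary-≤ {M} {X} {W} g uniq boundary = +-cancelˡ-≤ (length (edges g)) _ _ (begin
  length (edges g) + length W                        ≡⟨ length-++ (edges g) ⟨
  length (edges g ++ W)                              ≤⟨ Unique-⊆⇒length-≤ _≟ᵉ_ unique ⊆all ⟩
  length (rights ++ ups)                             ≡⟨ length-++ rights ⟩
  length rights + length ups                         ≡⟨ cong₂ _+_ (length-map _ X) (length-map _ X) ⟩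
  length X + length X                                ≡⟨ cong (λ k → length X + k) (+-identityʳ _) ⟨
  2 * length X                                       ≤⟨ count g ⟩
  2 * length M + length (edges g)                    ≡⟨ +-comm (2 * length M) _ ⟩
  length (edges g) + 2 * length M                    ∎)
  where
  open ≤-Reasoning
  rights ups : List Edge
  rights = map (λ p → p , right p) X
  ups    = map (λ p → p , up p) X
  unique : Unique (edges g ++ W)
  unique = Unique.++⁺ (distinctᵉ g) uniq λ (e∈ , e∈W) →
    proj₂ (proj₂ (All.lookup boundary e∈W)) (proj₂ (proj₂ (All.lookup (internal g) e∈)))
  from-X : ∀ {e} → IsEdge e → proj₁ e ∈ₗ X → e ∈ₗ rights ++ ups
  from-X (inj₁ refl) p∈X = ∈-++⁺ˡ (∈-map⁺ _ p∈X)
  from-X (inj₂ refl) p∈X = ∈-++⁺ʳ rights (∈-map⁺ _ p∈X)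
  ⊆all : (_∈ₗ edges g ++ W) ⊆ (_∈ₗ rights ++ ups)
  ⊆all e∈ with ∈-++⁻ (edges g) e∈
  ... | inj₁ e∈g = let isE , p∈X , _ = All.lookup (internal g) e∈g in from-X isE p∈X
  ... | inj₂ e∈W = let isE , p∈X , _ = All.lookup boundary e∈W in from-X isE p∈X

cells : ℕ → List Position
cells n = cartesianProduct (applyUpTo +_ n) (applyUpTo +_ n)

Q⊆cells : ∀ {n} → Q n ⊆ (_∈ₗ cells n)
Q⊆cells p∈Q with Q⇒pt p∈Q
... | _ , _ , x<n , y<n , refl = ∈-cartesianProduct⁺ (∈-applyUpTo⁺ +_ x<n) (∈-applyUpTo⁺ +_ y<n)

-- Growth never leaves the closed set `Q n`, so the number of additions is bounded by
-- `length (cells n)`; `enough` says that the fuel covers the positions still missing.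
saturate : ∀ {n M} → Unique M → (_∈ₗ M) ⊆ Q n → ∃[ X ] (Growth M X × Closed (_∈ₗ X))
saturate {n} {M} uniq M⊆Q = go (length (cells n)) (start uniq) (m≤m+n _ _)
  where
  X⊆Q : ∀ {X} → Growth M X → (_∈ₗ X) ⊆ Q n
  X⊆Q g = spanned g (Q n) (Q-closed n) M⊆Q
  go : ∀ fuel {X} → Growth M X → length (cells n) ≤ fuel + length X →
       ∃[ X ] (Growth M X × Closed (_∈ₗ X))
  go fuel {X} g enough
    with any? (λ p → ¬? (p ∈? X) ×-dec twoNeighbours? (_∈? X) p) (cells n)
  go fuel {X} g enough | no none = X , g , closed
    where
    closed : Closed (_∈ₗ X)
    closed {p} two with p ∈? X
    ... | yes p∈X = p∈X
    ... | no  p∉X = contradiction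
      (lose (Q⊆cells (Q-closed n (TwoNeighboursIn-mono (X⊆Q g) two))) (p∉X , two)) none
  go fuel {X} g enough | yes some with find some
  -- Without fuel, `X` already has as many positions as `cells n`, so no further one fits.
  go zero {X} g enough | yes some | p , _ , p∉X , two =
    contradiction (≤-trans (Unique-⊆⇒length-≤ _≟ᵖ_ (distinct g′) (Q⊆cells ∘ X⊆Q g′)) enough) 1+n≰n
    where g′ = extend g p∉X two
  go (suc fuel) {X} g enough | yes some | p , _ , p∉X , two =
    go fuel (extend g p∉X two) (subst (length (cells n) ≤_) (sym (+-suc fuel _)) enough)

-- The bridging argument

endRows : ℕ → PosSet
endRows n = row n bottom ∪ row n (top n)

disjoint : ∀ {A : Set} {P R : Pred A 0ℓ} {xs ys} → (∀ {v} → P v → R v → ⊥) →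
           All P xs → All R ys → Disjoint xs ys
disjoint P∩R=∅ Ps Rs (v∈xs , v∈ys) = P∩R=∅ (All.lookup Ps v∈xs) (All.lookup Rs v∈ys)

module Bridge {m : ℕ} {M X : List Position} {c : Position}
  (M⊆Q : (_∈ₗ M) ⊆ Q (suc m)) (few : 2 * length M + 4 ≤ 3 * suc m)
  (M-ends : (_∈ₗ M) Spans endRows (suc m)) (M∪c-Q : ((_∈ₗ M) ∪ ｛ c ｝) Spans Q (suc m))
  (g : Growth M X) (closed : Closed (_∈ₗ X)) where

  n : ℕ
  n = suc m

  X⊆Q : (_∈ₗ X) ⊆ Q n
  X⊆Q = spanned g (Q n) (Q-closed n) M⊆Q

  open Rows n closed

  Empty : ℕ → Set
  Empty y = ∀ {x} → x < n → pt x y ∉ₗ X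

  full? : Decidable Full
  full? y = allUpTo? (λ x → pt x y ∈? X) n

  bottom-full : Full 0
  bottom-full x<n = M-ends _ closed (extensive g) (inj₁ (pt∈Q x<n (s≤s z≤n) , refl))

  top-full : Full m
  top-full x<n = M-ends _ closed (extensive g) (inj₂ (pt∈Q x<n ≤-refl , refl))

  -- A position in row `y + 1` would fill that row directly. One in row `y + 2` would first give a
  -- position of row `y + 1`, because row `y` is full.
  gap-above : ∀ {y} → Full y → ¬ Full (suc y) → Empty (suc y) × Empty (suc (suc y))
  gap-above full ¬full =
    (λ x<n x∈X → ¬full (fill-above full x<n x∈X)) ,
    (λ x<n x∈X → ¬full (fill-above full x<n (fill-between (full x<n) x∈X)))

  gap-below : ∀ {y} → Full (suc (suc y)) → ¬ Full (suc y) → Empty y × Empty (suc y)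
  gap-below full ¬full =
    (λ x<n x∈X → ¬full (fill-below full x<n (fill-between x∈X (full x<n)))) ,
    (λ x<n x∈X → ¬full (fill-below full x<n x∈X))

  -- Two consecutive empty rows are never entered from outside, so c lies in one of them.
  c-in-gap : ∀ {b} → b < n → Empty b → Empty (suc b) →
             ∃[ k ] (proj₂ c ≡ + k × b ≤ k × k ≤ suc b)
  c-in-gap {b} b<n empty₁ empty₂ with proj₂ c ℤ.≟ + b | proj₂ c ℤ.≟ + suc b
  ... | yes c≡ | _      = b , c≡ , ≤-refl , n≤1+n b
  ... | no _   | yes c≡ = suc b , c≡ , n≤1+n b , ≤-refl
  ... | no c≢b | no c≢1+b = contradiction refl
    (proj₁ (M∪c-Q _ (twoRowsOmitted-closed b) outside (pt∈Q {x = 0} (s≤s z≤n) b<n)))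
    where
    outside : ((_∈ₗ M) ∪ ｛ c ｝) ⊆ (λ p → proj₂ p ≢ + b × proj₂ p ≢ + suc b)
    outside (inj₂ refl) = c≢b , c≢1+b
    outside (inj₁ p∈M) with Q⇒pt (M⊆Q p∈M)
    ... | x , y , x<n , _ , refl =
      (λ { refl → empty₁ x<n (extensive g p∈M) }) , (λ { refl → empty₂ x<n (extensive g p∈M) })

  lowest-gap : ∀ k → (∀ {y} → y ≤ k → Full y) ⊎
                     ∃[ b ] (b < k × (∀ {y} → y ≤ b → Full y) × ¬ Full (suc b))
  lowest-gap zero = inj₁ λ { z≤n → bottom-full }
  lowest-gap (suc k) with lowest-gap k | full? (suc k)
  ... | inj₂ (b , b<k , rest) | _        = inj₂ (b , m≤n⇒m≤1+n b<k , rest)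
  ... | inj₁ full             | no ¬full = inj₂ (k , ≤-refl , full , ¬full)
  ... | inj₁ full             | yes full′ = inj₁ λ y≤1+k → case y≤1+k
    where
    case : ∀ {y} → y ≤ suc k → Full y
    case y≤1+k with m≤n⇒m<n∨m≡n y≤1+k
    ... | inj₁ (s≤s y≤k) = full y≤k
    ... | inj₂ refl      = full′

  module Gap {b : ℕ} (b<m : b < m) (full : ∀ {y} → y ≤ b → Full y) (¬full : ¬ Full (suc b)) where

    empty₁ : Empty (suc b)
    empty₁ = proj₁ (gap-above (full ≤-refl) ¬full)

    empty₂ : Empty (suc (suc b))
    empty₂ = proj₂ (gap-above (full ≤-refl) ¬full)

    ¬empty-top : ∀ {y} → Empty y → y ≢ m
    ¬empty-top empty refl = empty (s≤s z≤n) (top-full (s≤s z≤n))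

    -- The top row is full, so it is neither of the two empty rows just above row `b`.
    4+b≤n : 4 + b ≤ n
    4+b≤n = s≤s (≤∧≢⇒< (≤∧≢⇒< b<m (¬empty-top empty₁)) (¬empty-top empty₂))

    c-low : ∃[ k ] (proj₂ c ≡ + k × k ≤ suc (suc b))
    c-low with c-in-gap (s≤s b<m) empty₁ empty₂
    ... | k , c≡ , _ , k≤ = k , c≡ , k≤

    -- Downward induction from the top row, with `d` the distance to it. A first failure would
    -- produce a second pair of empty rows, again containing `c`; but all of that pair lies at
    -- height `3 + b` or more and `c` at height at most `2 + b`. Row `3 + b` itself is left open:
    -- its pair would include row `2 + b`, where `c` may lie.
    full-above : ∀ d {y} → d + y ≡ m → 4 + b ≤ y → Full y
    full-above zero    refl _ = top-full
    full-above (suc d) {suc y} eq (s≤s 3+b≤y) with full? (suc y)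
    ... | yes full = full
    ... | no ¬full
      with e₁ , e₂ ← gap-below (full-above d (trans (+-suc d (suc y)) eq) (m≤n⇒m≤1+n (s≤s 3+b≤y))) ¬full
      with k , c≡k , k≤2+b ← c-low
      with k′ , c≡k′ , y≤k′ , _ ← c-in-gap (<-trans (n<1+n y) (s≤s (subst (suc y ≤_) eq (m≤n+m (suc y) (suc d))))) e₁ e₂
      with refl ← ℤ.+-injective (trans (sym c≡k) c≡k′)
      = contradiction (≤-trans 3+b≤y (≤-trans y≤k′ k≤2+b)) 1+n≰n

    h : ℕ
    h = n ∸ (4 + b)

    above : ℕ → ℕ
    above i = 4 + b + i

    above<n : ∀ {i} → i < h → above i < n
    above<n {i} i<h = subst (above i <_) (m+[n∸m]≡n 4+b≤n) (+-monoʳ-< (4 + b) i<h)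

    vertical horizontal : Position → Edge
    vertical   p = p , up p
    horizontal p = p , right p

    -- Four families of boundary sides of `X`: the upper sides of the top row and of the last full
    -- row `b` below the gap, and the right ends of rows `0` to `b` and of the `h` rows from `4 + b`
    -- upwards.
    topEdge gapEdge lowerEdge upperEdge : ℕ → Edge
    topEdge x   = vertical (pt x m)
    gapEdge x   = vertical (pt x b)
    lowerEdge y = horizontal (pt m y)
    upperEdge i = horizontal (pt m (above i))

    topEdges gapEdges lowerEdges upperEdges W : List Edge
    topEdges   = applyUpTo topEdge n
    gapEdges   = applyUpTo gapEdge n
    lowerEdges = applyUpTo lowerEdge (suc b)
    upperEdges = applyUpTo upperEdge h
    W = (topEdges ++ gapEdges) ++ (lowerEdges ++ upperEdges)

    Boundary : Edge → Set
    Boundary e = IsEdge e × proj₁ e ∈ₗ X × proj₂ e ∉ₗ X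

    boundary-right : ∀ {y} → y < n → Full y → Boundary (horizontal (pt m y))
    boundary-right y<n full = inj₁ refl , full ≤-refl , λ r∈X → case (X⊆Q r∈X)
      where
      case : ¬ Q n (right (pt m _))
      case ((_ , +<+ m+1<n) , _) = <-irrefl (+-comm m 1) m+1<n

    W-boundary : All Boundary W
    W-boundary = All.++⁺
      (All.++⁺
        (All.applyUpTo⁺₁ topEdge n λ x<n → inj₂ refl , top-full x<n , λ u∈X → above-top (X⊆Q u∈X))
        (All.applyUpTo⁺₁ gapEdge n λ {x} x<n → inj₂ refl , full ≤-refl x<n ,
          λ u∈X → empty₁ x<n (subst (_∈ₗ X) (cong (+ x ,_) (+m+1 b)) u∈X)))
      (All.++⁺
        (All.applyUpTo⁺₁ lowerEdge (suc b) λ { (s≤s y≤b) →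
          boundary-right (s≤s (≤-trans y≤b (<⇒≤ b<m))) (full y≤b) })
        (All.applyUpTo⁺₁ upperEdge h λ {i} i<h → boundary-right (above<n i<h)
          (full-above (m ∸ above i) (m∸n+n≡m (s≤s⁻¹ (above<n i<h))) (m≤m+n _ i))))
      where
      above-top : ∀ {x} → ¬ Q n (up (pt x m))
      above-top (_ , (_ , +<+ m+1<n)) = <-irrefl (+-comm m 1) m+1<n

    applyUpTo-unique : ∀ (f : ℕ → Edge) k → (∀ {i j} → f i ≡ f j → i ≡ j) → Unique (applyUpTo f k)
    applyUpTo-unique f k inj = Unique.applyUpTo⁺₁ f k λ i<j _ eq → <-irrefl (inj eq) i<j

    W-unique : Unique W
    W-unique = Unique.++⁺
      (Unique.++⁺
        (applyUpTo-unique topEdge n (pt-x ∘ cong proj₁))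
        (applyUpTo-unique gapEdge n (pt-x ∘ cong proj₁))
        (disjoint {P = λ e → proj₂ (proj₁ e) ≡ + m} {R = λ e → proj₂ (proj₁ e) ≡ + b}
          (λ a b≡ → <-irrefl (ℤ.+-injective (trans (sym b≡) a)) b<m)
          (All.applyUpTo⁺₁ topEdge n λ _ → refl) (All.applyUpTo⁺₁ gapEdge n λ _ → refl)))
      (Unique.++⁺
        (applyUpTo-unique lowerEdge (suc b) (pt-y ∘ cong proj₁))
        (applyUpTo-unique upperEdge h (+-cancelˡ-≡ (4 + b) _ _ ∘ pt-y ∘ cong proj₁))
        (disjoint {P = λ e → ∃[ y ] (y ≤ b × proj₂ (proj₁ e) ≡ + y)}
                  {R = λ e → ∃[ i ] (proj₂ (proj₁ e) ≡ + above i)}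
          (λ { (y , y≤b , a) (i , a′) → 1+n≰n (≤-trans (m≤n+m (suc b) 3)
               (≤-trans (m≤m+n (4 + b) i)
               (≤-trans (≤-reflexive (ℤ.+-injective (trans (sym a′) a))) y≤b))) })
          (All.applyUpTo⁺₁ lowerEdge (suc b) λ { {y} (s≤s y≤b) → y , y≤b , refl })
          (All.applyUpTo⁺₁ upperEdge h λ {i} _ → i , refl)))
      (disjoint {P = IsVertical} {R = ¬_ ∘ IsVertical} (λ a ¬a → ¬a a)
        (All.++⁺ {xs = topEdges} (All.applyUpTo⁺₁ topEdge n λ _ → refl)
                                 (All.applyUpTo⁺₁ gapEdge n λ _ → refl))
        (All.++⁺ {xs = lowerEdges} (All.applyUpTo⁺₁ lowerEdge (suc b) λ _ → ¬vertical)
                                   (All.applyUpTo⁺₁ upperEdge h λ _ → ¬vertical)))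
      where
      IsVertical : Edge → Set
      IsVertical e = proj₁ (proj₂ e) ≡ proj₁ (proj₁ e)
      ¬vertical : + (m + 1) ≢ + m
      ¬vertical eq = m≢1+n+m m (sym (trans (+-comm 1 m) (ℤ.+-injective eq)))

    -- Every column contributes 2, and every row contributes 1 except rows `1 + b`, `2 + b` and
    -- `3 + b`.
    length-W : 3 + length W ≡ 3 * n
    length-W = begin
      3 + length W
        ≡⟨ cong (λ k → 3 + k) (length-++ (topEdges ++ gapEdges)) ⟩
      3 + (length (topEdges ++ gapEdges) + length (lowerEdges ++ upperEdges))
        ≡⟨ cong (λ k → 3 + k) (cong₂ _+_ (length-++ topEdges) (length-++ lowerEdges)) ⟩
      3 + ((length topEdges + length gapEdges) + (length lowerEdges + length upperEdges))
        ≡⟨ cong (λ k → 3 + k) (cong₂ _+_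
             (cong₂ _+_ (length-applyUpTo topEdge n) (length-applyUpTo gapEdge n))
             (cong₂ _+_ (length-applyUpTo lowerEdge (suc b)) (length-applyUpTo upperEdge h))) ⟩
      3 + ((n + n) + (suc b + h))
        ≡⟨ rearrange n (suc b + h) ⟩
      n + (n + ((4 + b + h) + 0))
        ≡⟨ cong (λ k → n + (n + (k + 0))) (m+[n∸m]≡n 4+b≤n) ⟩
      3 * n ∎
      where
      open ≡-Reasoning
      rearrange : ∀ n k → 3 + ((n + n) + k) ≡ n + (n + ((3 + k) + 0))
      rearrange = solve-∀

    absurd : ⊥
    -- The chain is `4 + 2 |M| ≤ 3 n = 3 + |W| ≤ 3 + 2 |M|`.
    absurd = 1+n≰n (≤-trans (≤-reflexive (+-comm 4 (2 * length M))) (≤-trans few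
      (≤-trans (≤-reflexive (sym length-W)) (+-monoʳ-≤ 3 (boundary-≤ g W-unique W-boundary)))))

  M-Q : (_∈ₗ M) Spans Q n
  M-Q Y closedY M⊆Y p∈Q with lowest-gap m
  ... | inj₂ (b , b<m , full , ¬full) = ⊥-elim (Gap.absurd b<m full ¬full)
  ... | inj₁ full with Q⇒pt p∈Q
  ...   | x , y , x<n , y<n , refl = spanned g Y closedY M⊆Y (full (s≤s⁻¹ y<n) x<n)

bridge : ∀ {m M c} → Unique M → (_∈ₗ M) ⊆ Q (suc m) → 2 * length M + 4 ≤ 3 * suc m →
         (_∈ₗ M) Spans endRows (suc m) → ((_∈ₗ M) ∪ ｛ c ｝) Spans Q (suc m) →
         (_∈ₗ M) Spans Q (suc m)
bridge unique M⊆Q few M-ends M∪c-Q with saturate unique M⊆Q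
... | _ , g , closed = Bridge.M-Q M⊆Q few M-ends M∪c-Q g closed

-- Moves

module _ {A B : Configuration} (move : Move A B) where
  open Move move

  remaining : List Position
  remaining = filter (λ q → ¬? (q ≟ᵖ c)) (coins A)

  remaining-unique : Unique remaining
  remaining-unique = Unique.filter⁺ _ (Configuration.distinct A)

  remaining⊆A : (_∈ₗ remaining) ⊆ ⟦ A ⟧
  remaining⊆A = proj₁ ∘ ∈-filter⁻ _

  A∖c⊆remaining : (⟦ A ⟧ ∖ ｛ c ｝) ⊆ (_∈ₗ remaining)
  A∖c⊆remaining (q∈A , q≢c) = ∈-filter⁺ _ q∈A (q≢c ∘ sym)

  A⊆remaining∪c : ⟦ A ⟧ ⊆ (_∈ₗ remaining) ∪ ｛ c ｝
  A⊆remaining∪c {q} q∈A with c ≟ᵖ q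
  ... | yes c≡q = inj₂ c≡q
  ... | no  c≢q = inj₁ (A∖c⊆remaining (q∈A , c≢q))

  B⊆p∷remaining : ⟦ B ⟧ ⊆ (_∈ₗ p ∷ remaining)
  B⊆p∷remaining = [ there ∘ A∖c⊆remaining , (λ { refl → here refl }) ]′ ∘ proj₁ result

  remaining⊆B : (_∈ₗ remaining) ⊆ ⟦ B ⟧
  remaining⊆B q∈ with ∈-filter⁻ _ q∈
  ... | q∈A , q≢c = proj₂ result (inj₁ (q∈A , q≢c ∘ sym))

  remaining-size : length remaining < size A
  remaining-size = filter-notAll _ (coins A) (lose c∈A λ c≢c → c≢c refl)

  -- The new coin `p` has two neighbours among the remaining coins, so every closed set containing
  -- those contains `p` too: only lifting a coin can change the span, never placing it.
  remaining-spans : ∀ {R} → ⟦ B ⟧ Spans R → (_∈ₗ remaining) Spans R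
  remaining-spans B-R X closed rem⊆X = B-R X closed λ q∈B → ⊆X (B⊆p∷remaining q∈B)
    where
    ⊆X : (_∈ₗ p ∷ remaining) ⊆ X
    ⊆X (here refl) = closed (TwoNeighboursIn-mono (rem⊆X ∘ A∖c⊆remaining) support)
    ⊆X (there q∈)  = rem⊆X q∈

  before-spans : ∀ {R} → ⟦ B ⟧ Spans R → ⟦ A ⟧ Spans R
  before-spans B-R X closed A⊆X = remaining-spans B-R X closed (A⊆X ∘ remaining⊆A)

-- The invariant carried along the moves. Lifting one coin turns `few` into `2 |M| + 4 ≤ 3 n`, the
-- bound required by `bridge`.
record Bridged (n : ℕ) (A : Configuration) : Set₁ where
  field
    inside  : ⟦ A ⟧ ⊆ Q n
    few     : 2 * size A + 2 ≤ 3 * n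
    spanning : ⟦ A ⟧ Spans Q n

open Bridged

move-bridged : ∀ {m A B} → Move A B → ⟦ B ⟧ Spans endRows (suc m) →
               Bridged (suc m) A → Bridged (suc m) B
move-bridged {m} {A} {B} move B-ends A-ok = record
  { inside   = λ q∈B → Q-closed-in (B⊆p∷remaining move q∈B)
  ; few      = ≤-trans (+-monoˡ-≤ 2 (*-monoʳ-≤ 2 (≤-trans
                 (Unique-⊆⇒length-≤ _≟ᵖ_ (Configuration.distinct B) (B⊆p∷remaining move))
                 (remaining-size move)))) (few A-ok)
  ; spanning = λ X closed B⊆X → bridge (remaining-unique move) (inside A-ok ∘ remaining⊆A move)
      few′ (remaining-spans move B-ends)
      (λ Y closedY ⊆Y → spanning A-ok Y closedY (⊆Y ∘ A⊆remaining∪c move))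
      X closed (B⊆X ∘ remaining⊆B move)
  }
  where
  open Move move
  Q-closed-in : (_∈ₗ p ∷ remaining move) ⊆ Q (suc m)
  Q-closed-in (here refl) =
    Q-closed _ (TwoNeighboursIn-mono (inside A-ok ∘ proj₁) support)
  Q-closed-in (there q∈)  = inside A-ok (remaining⊆A move q∈)
  few′ : 2 * length (remaining move) + 4 ≤ 3 * suc m
  few′ = begin
    2 * length (remaining move) + 4        ≡⟨ rearrange (length (remaining move)) ⟩
    2 * suc (length (remaining move)) + 2  ≤⟨ +-monoˡ-≤ 2 (*-monoʳ-≤ 2 (remaining-size move)) ⟩
    2 * size A + 2                         ≤⟨ few A-ok ⟩
    3 * suc m                              ∎
    where
    open ≤-Reasoning
    rearrange : ∀ k → 2 * k + 4 ≡ 2 * suc k + 2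
    rearrange = solve-∀

-- Spanning the end rows is inherited backwards from the last configuration, while `Bridged` is
-- propagated forwards and needs the former at each step; one recursion returns both.
moves-bridged : ∀ {m A B} → Star Move A B → ⟦ B ⟧ Spans endRows (suc m) →
                ⟦ A ⟧ Spans endRows (suc m) × (Bridged (suc m) A → Bridged (suc m) B)
moves-bridged ε              B-ends = B-ends , id
moves-bridged (move ◅ moves) B-ends with moves-bridged moves B-ends
... | A′-ends , ok = before-spans move A′-ends , ok ∘ move-bridged move A′-ends

-- The two configurations

-- Lowering the side length and the index by 1 together does not change a path position. The
-- recursion therefore ends on the bottom arm, at the corner or on the vertical arm.
path-steps : ∀ m k → ∃[ q ] ∃[ r ]
  (q ≢ r × q ∈ₗ neighbours (path (suc m) (suc k)) × r ∈ₗ neighbours (path (suc m) (suc k)) ×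
   q ≡ path (suc m) k × r ≡ path (suc m) (suc (suc k)))
path-steps zero          k = _ , _ , m≢1+n+m k ∘ pt-x , west-of , east-of , cong (pt k) (sym (0∸n≡0 k)) , refl
path-steps (suc zero)    zero    = _ , _ , (λ ()) , north , east , refl , refl
path-steps (suc (suc m)) zero    = _ , _ , (λ ()) , north-of , south-of , refl , cong (λ x → pt x m) (sym (0∸n≡0 m))
path-steps (suc m)       (suc k) = path-steps m k

parity : ∀ k → (∃[ j ] k ≡ 2 * j) ⊎ (∃[ j ] k ≡ suc (2 * j))
parity zero = inj₁ (0 , refl)
parity (suc k) with parity k
... | inj₁ (j , refl) = inj₂ (j , refl)
... | inj₂ (j , refl) = inj₁ (suc j , sym (*-suc 2 j))

L-spans-Q : ∀ m → L (suc m) Spans Q (suc m)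
L-spans-Q m X closed L⊆X p∈Q with Q⇒pt p∈Q
... | x , y , x<n , y<n , refl = full y (s≤s⁻¹ y<n) x<n
  where
  n = suc m
  open Rows n closed
  2n∸2 : 2 * n ∸ 2 ≡ 2 * m
  2n∸2 = cong (_∸ 2) (*-suc 2 m)
  even : ∀ j → 2 * j ≤ 2 * m → path n (2 * j) ∈ X
  even j 2j≤2m = L⊆X (2 * j , subst (2 * j ≤_) (sym 2n∸2) 2j≤2m , divides j (*-comm 2 j) , refl)
  odd : ∀ j → 2 * suc j ≤ 2 * m → path n (suc (2 * j)) ∈ X
  odd j ≤2m with path-steps m (2 * j)
  ... | q , r , q≢r , q∈ , r∈ , refl , refl = closed (q , r , q≢r , q∈ , r∈ ,
    even j (≤-trans (*-monoʳ-≤ 2 (n≤1+n j)) ≤2m) ,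
    subst (λ k → path n k ∈ X) (*-suc 2 j) (even (suc j) ≤2m))
  path∈X : ∀ k → k ≤ 2 * m → path n k ∈ X
  path∈X k k≤2m with parity k
  ... | inj₁ (j , refl) = even j k≤2m
  -- An odd index below the even number `2 * m` has its successor within range as well.
  ... | inj₂ (j , refl) = odd j (*-monoʳ-≤ 2 (*-cancelˡ-< 2 j m k≤2m))
  full : ∀ y → y ≤ m → Full y
  -- Index `m + x` is the position `(x , 0)` of the horizontal arm.
  full zero _ {x} x<n = subst (_∈ X)
    (cong₂ pt (m+n∸m≡n m x) (m≤n⇒m∸n≡0 (m≤m+n m x)))
    (path∈X (m + x) (subst (λ k → m + x ≤ m + k) (sym (+-identityʳ m)) (+-monoʳ-≤ m (s≤s⁻¹ x<n))))
  -- Index `m ∸ suc y` is the position `(0 , y + 1)` of the vertical arm, from which the row fills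
  -- along the full row below.
  full (suc y) y<m = fill-above (full y (<⇒≤ y<m)) (s≤s z≤n) (subst (_∈ X)
    (cong₂ pt (m≤n⇒m∸n≡0 (m∸n≤m m (suc y))) (m∸[m∸n]≡n y<m))
    (path∈X (m ∸ suc y) (≤-trans (m∸n≤m m (suc y)) (m≤m+n m _))))

nearest-below : ∀ {P : Pred ℕ 0ℓ} → Decidable P → P 0 → ∀ x → ¬ P x →
                ∃[ l ] (l < x × P l × (∀ {k} → l < k → k ≤ x → ¬ P k))
nearest-below P? P0 zero    ¬Px = contradiction P0 ¬Px
nearest-below {P} P? P0 (suc x) ¬Px with P? x
... | yes Px = x , ≤-refl , Px , λ x<k k≤1+x → subst (¬_ ∘ P) (≤-antisym x<k k≤1+x) ¬Px
... | no ¬Px′ with nearest-below P? P0 x ¬Px′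
...   | l , l<x , Pl , none = l , m≤n⇒m≤1+n l<x , Pl , none′
  where
  none′ : ∀ {k} → l < k → k ≤ suc x → ¬ P k
  none′ l<k k≤1+x with m≤n⇒m<n∨m≡n k≤1+x
  ... | inj₁ (s≤s k≤x) = none l<k k≤x
  ... | inj₂ refl      = ¬Px

nearest-above : ∀ {P : Pred ℕ 0ℓ} → Decidable P → ∀ d {x} → P (d + x) → ¬ P x →
                ∃[ r ] (x < r × P r × (∀ {k} → x ≤ k → k < r → ¬ P k))
nearest-above P? zero    Pm ¬Px = contradiction Pm ¬Px
nearest-above {P} P? (suc d) {x} Pm ¬Px with P? (suc x)
... | yes P1+x = suc x , ≤-refl , P1+x , λ x≤k k<1+x → subst (¬_ ∘ P) (≤-antisym x≤k (s≤s⁻¹ k<1+x)) ¬Px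
... | no ¬P1+x with nearest-above P? d (subst P (sym (+-suc d x)) Pm) ¬P1+x
...   | r , 1+x<r , Pr , none = r , <-trans (n<1+n x) 1+x<r , Pr , none′
  where
  none′ : ∀ {k} → x ≤ k → k < r → ¬ P k
  none′ x≤k k<r with m≤n⇒m<n∨m≡n x≤k
  ... | inj₁ x<k  = none x<k k<r
  ... | inj₂ refl = ¬Px

none-between : ∀ {P : Pred ℤ 0ℓ} {l x r} → (∀ {k} → l < k → k ≤ x → ¬ P (+ k)) →
               (∀ {k} → x ≤ k → k < r → ¬ P (+ k)) → ∀ z → + l ℤ.< z → z ℤ.< + r → ¬ P z
none-between {x = x} none-l none-r (+ k) (+<+ l<k) (+<+ k<r) with ≤-total k x
... | inj₁ k≤x = none-l l<k k≤x
... | inj₂ x≤k = none-r x≤k k<r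

difference : ∀ {r l d} → + r ℤ.- + l ≡ + d → r ≡ d + l
difference {r} {l} {d} eq = ℤ.+-injective (begin
  + r                       ≡⟨ ℤ.+-identityʳ (+ r) ⟨
  + r ℤ.+ + 0               ≡⟨ cong (λ z → + r ℤ.+ z) (ℤ.+-inverseˡ (+ l)) ⟨
  + r ℤ.+ (ℤ.- + l ℤ.+ + l) ≡⟨ ℤ.+-assoc (+ r) (ℤ.- + l) (+ l) ⟨
  + r ℤ.- + l ℤ.+ + l       ≡⟨ cong (λ z → z ℤ.+ + l) eq ⟩
  + (d + l)                 ∎)
  where open ≡-Reasoning

-- The nearest coins on the two sides of the free position are consecutive, hence at distance 1 or
-- 2. Distance 1 leaves no room for it, and distance 2 makes them its two neighbours.
rowL-gap-supported : ∀ {m y S} → IsRowL (suc m) y S → ∀ {x} → x ≤ m →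
                     (+ x , y) ∉ ⟦ S ⟧ → (+ x , y) ∈ TwoNeighboursIn ⟦ S ⟧
rowL-gap-supported {m} {y} {S} isRowL {x} x≤m x∉S
  with l , l<x , l∈S , none-l ← nearest-below (λ k → (+ k , y) ∈? coins S) (IsRowL.leftEnd isRowL) x x∉S
  with r , x<r , r∈S , none-r ← nearest-above (λ k → (+ k , y) ∈? coins S) (m ∸ x)
         (subst (λ k → (+ k , y) ∈ ⟦ S ⟧) (sym (m∸n+n≡m x≤m)) (IsRowL.rightEnd isRowL)) x∉S
  with IsRowL.gaps isRowL (+ l) (+ r) l∈S r∈S (+<+ (<-trans l<x x<r)) (none-between {λ z → (z , y) ∈ ⟦ S ⟧} none-l none-r)
... | inj₁ r-l≡1 with refl ← difference {r} {l} {1} r-l≡1 = contradiction (≤-trans x<r l<x) 1+n≰n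
... | inj₂ r-l≡2 with refl ← difference {r} {l} {2} r-l≡2 with refl ← ≤-antisym l<x (s≤s⁻¹ x<r) =
  (+ l , y) , (+ suc (suc l) , y) , (λ ()) ∘ cong proj₁ , here refl ,
  there (here (cong (_, y) (sym (+m+1 (suc l))))) , l∈S , r∈S

rowL-spans-row : ∀ {m y S} → IsRowL (suc m) y S → ⟦ S ⟧ Spans row (suc m) y
rowL-spans-row {S = S} isRowL X closed S⊆X (p∈Q , refl) with Q⇒pt p∈Q
... | x , y , x<n , _ , refl with pt x y ∈? coins S
...   | yes p∈S = S⊆X p∈S
...   | no  p∉S = closed (TwoNeighboursIn-mono S⊆X (rowL-gap-supported isRowL (s≤s⁻¹ x<n) p∉S))

-- With `n = k + 2`, the `n` coins of the L and the `⌊ k /2⌋` others give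
-- `2 |A| + 2 ≤ 2 n + k + 2 = 3 n`.
IsA⇒Bridged : ∀ {m A} → suc m ≥ 2 → IsA (suc m) A → Bridged (suc m) A
IsA⇒Bridged {zero} (s≤s ()) _
IsA⇒Bridged {suc k} {A} n≥2 (A⊆Q , E , size-E , _ , _ , A≐L∪E) = record
  { inside   = A⊆Q
  ; few      = begin
      2 * size A + 2                        ≤⟨ +-monoˡ-≤ 2 (*-monoʳ-≤ 2 size-A) ⟩
      2 * (n + ⌊ k /2⌋) + 2                 ≡⟨ rearrange k ⌊ k /2⌋ ⟩
      6 + (k + k) + (⌊ k /2⌋ + ⌊ k /2⌋)     ≤⟨ +-monoʳ-≤ (6 + (k + k)) half ⟩
      6 + (k + k) + k                       ≡⟨ rearrange′ k ⟩
      3 * n                                 ∎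
  ; spanning = λ X closed A⊆X → L-spans-Q (suc k) X closed (A⊆X ∘ proj₂ A≐L∪E ∘ inj₁)
  }
  where
  open ≤-Reasoning
  n = suc (suc k)
  evens : List Position
  evens = applyUpTo (λ j → path n (2 * j)) n
  evens⁺ : ∀ {j} → j < n → path n (2 * j) ∈ₗ evens
  evens⁺ = ∈-applyUpTo⁺ (λ j → path n (2 * j))
  A⊆ : ⟦ A ⟧ ⊆ (_∈ₗ evens ++ coins E)
  A⊆ p∈A with proj₁ A≐L∪E p∈A
  ... | inj₂ p∈E = ∈-++⁺ʳ evens p∈E
  ... | inj₁ (_ , 2j≤ , divides j refl , refl) = ∈-++⁺ˡ (subst (λ i → path n i ∈ₗ evens) (*-comm 2 j)
    (evens⁺ {j} (s≤s (*-cancelˡ-≤ 2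
      (subst₂ _≤_ (*-comm j 2) (cong (_∸ 2) (*-suc 2 (suc k))) 2j≤)))))
  size-A : size A ≤ n + ⌊ k /2⌋
  size-A = begin
    size A                             ≤⟨ Unique-⊆⇒length-≤ _≟ᵖ_ (Configuration.distinct A) A⊆ ⟩
    length (evens ++ coins E)          ≡⟨ length-++ evens ⟩
    length evens + size E              ≡⟨ cong₂ _+_ (length-applyUpTo (λ j → path n (2 * j)) n) size-E ⟩
    n + ⌊ k /2⌋                        ∎
  half : ⌊ k /2⌋ + ⌊ k /2⌋ ≤ k
  half = ≤-trans (+-monoʳ-≤ ⌊ k /2⌋ (⌊n/2⌋≤⌈n/2⌉ k)) (≤-reflexive (⌊n/2⌋+⌈n/2⌉≡n k))
  rearrange : ∀ k h → 2 * (suc (suc k) + h) + 2 ≡ 6 + (k + k) + (h + h)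
  rearrange = solve-∀
  rearrange′ : ∀ k → 6 + (k + k) + k ≡ 3 * suc (suc k)
  rearrange′ = solve-∀

-- The claims of the theorem

unreachable : ∀ {m A B} → m ≥ 3 → IsA (suc m) A → IsB (suc m) B → ¬ (A ⇝ B)
unreachable {m} {A} {B} m≥3 A-ok (_ , T , U , T-ok , U-ok , E , _ , E⊆row , _ , B≐) (C , moves , C≐B) =
  -- The coins of `C` lie on two lines forming a closed set, which misses the position `(0 , 1)` of
  -- `Q`.
  [ (λ ()) , (λ 1≡m → <⇒≢ (≤-trans (s≤s (s≤s z≤n)) m≥3) (ℤ.+-injective 1≡m)) ]′
      (spanning C-ok _ (twoLines-closed m≥3) C⊆lines (pt∈Q {x = 0} {y = 1} (s≤s z≤n) (s≤s m≥1)))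
  where
  m≥1 : m ≥ 1
  m≥1 = ≤-trans (s≤s z≤n) m≥3
  S⊆C : ⟦ T ⟧ ∪ ⟦ U ⟧ ⊆ ⟦ C ⟧
  S⊆C = proj₂ C≐B ∘ proj₂ B≐ ∘ inj₁
  C-ends : ⟦ C ⟧ Spans endRows (suc m)
  C-ends X closed C⊆X (inj₁ p∈row) = rowL-spans-row U-ok X closed (C⊆X ∘ S⊆C ∘ inj₂) p∈row
  C-ends X closed C⊆X (inj₂ p∈row) = rowL-spans-row T-ok X closed (C⊆X ∘ S⊆C ∘ inj₁) p∈row
  C⊆lines : ⟦ C ⟧ ⊆ (λ p → proj₂ p ≡ + 0 ⊎ proj₂ p ≡ + m)
  C⊆lines p∈C with proj₁ B≐ (proj₁ C≐B p∈C)
  ... | inj₁ (inj₁ p∈T) = inj₂ (proj₂ (IsRowL.inRow T-ok p∈T))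
  ... | inj₁ (inj₂ p∈U) = inj₁ (proj₂ (IsRowL.inRow U-ok p∈U))
  ... | inj₂ p∈E        = inj₁ (proj₂ (E⊆row p∈E))
  C-ok : Bridged (suc m) C
  C-ok = proj₂ (moves-bridged moves C-ends) (IsA⇒Bridged (s≤s m≥1) A-ok)

-- Without the additional coins the whole L is still there, and it already spans `Q`.
extra-coins : ∀ {m k A} → ⟦ A ⟧ ⊆ Q (suc m) → WithBottomCoins (suc m) (L (suc m)) k A →
              HasExtraCoins k A
extra-coins {m} {A = A} A⊆Q (E , size-E , _ , E⊆∁L , A≐) =
  E , proj₂ A≐ ∘ inj₂ , size-E ,
  ( span-⊆ (span-closed (_∈? coins A)) (stage⊆span ⟦ A ⟧ 0 ∘ proj₁)
  , span-⊆ closed (λ p∈A → L-spans-Q m _ closed L⊆ (A⊆Q p∈A)))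
  where
  closed : Closed (span (⟦ A ⟧ ∖ ⟦ E ⟧))
  closed = span-closed λ p → (p ∈? coins A) ×-dec ¬? (p ∈? coins E)
  L⊆ : L (suc m) ⊆ span (⟦ A ⟧ ∖ ⟦ E ⟧)
  L⊆ p∈L = stage⊆span _ 0 (proj₂ A≐ (inj₁ p∈L) , λ p∈E → E⊆∁L p∈E p∈L)

-- Each additional coin fills a gap of the row L `U` and is supported by coins of `U`. These are
-- never among the removed ones, so any order of removal works.
redundant-coins : ∀ {m k S U B} → IsRowL (suc m) bottom U → ⟦ U ⟧ ⊆ S →
                  WithBottomCoins (suc m) S k B → HasRedundantCoins k B
redundant-coins {m} {S = S} {U} {B} U-ok U⊆S (E , refl , E⊆row , E⊆∁S , B≐) =
  lookup (coins E) ,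
  lookup-injective (Configuration.distinct E) ,
  (λ i → proj₂ B≐ (inj₂ (∈-lookup i))) ,
  (λ i → TwoNeighboursIn-mono
    (λ q∈U → proj₂ B≐ (inj₁ (U⊆S q∈U)) , λ { (j , _ , refl) → E⊆∁S (∈-lookup j) (U⊆S q∈U) })
    (supported (∈-lookup i)))
  where
  supported : ∀ {p} → p ∈ ⟦ E ⟧ → p ∈ TwoNeighboursIn ⟦ U ⟧
  supported p∈E with E⊆row p∈E
  ... | p∈Q , y≡0 with Q⇒pt p∈Q
  supported p∈E | p∈Q , refl | _ , _ , x<n , _ , refl =
    rowL-gap-supported U-ok (s≤s⁻¹ x<n) (E⊆∁S p∈E ∘ U⊆S)

corollary4p3 : ∀ (n : ℕ) → n ≥ 9 →
    ∀ (A B : Configuration) → IsA n A → IsB n B →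
    ¬ (A ⇝ B)
    × HasExtraCoins ⌊ n ∸ 2 /2⌋ A
    × HasRedundantCoins ⌊ n ∸ 5 /2⌋ B
    × span ⟦ A ⟧ ⊇ span ⟦ B ⟧
corollary4p3 (suc m) (s≤s m≥8) A B A-ok@(A⊆Q , A-shape) B-ok@(B⊆Q , T , U , _ , U-ok , B-shape) =
  unreachable {m} {A} {B} (≤-trans (m≤m+n 3 5) m≥8) A-ok B-ok ,
  extra-coins {m} {A = A} A⊆Q A-shape ,
  redundant-coins {m} {S = ⟦ T ⟧ ∪ ⟦ U ⟧} {U} {B} U-ok inj₂ B-shape ,
  -- `B` lies in `Q`, which is contained in the closed set `span ⟦ A ⟧`.
  span-⊆ closed (spanning (IsA⇒Bridged {m} {A} (s≤s (≤-trans (s≤s z≤n) m≥8)) A-ok) _ closed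
    (stage⊆span ⟦ A ⟧ 0) ∘ B⊆Q)
  where
  closed : Closed (span ⟦ A ⟧)
  closed = span-closed (_∈? coins A)
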